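{- Fix a signed triangle $T$. There exists a one-sided tester for signed triangle freeness (with respect to $T$) in the bounded-degree signed graph model with query complexity $O(1/\epsilon)$, where the implied constant may depend (polynomially) on the degree bound $d$.
   Context: A signed graph is $G=(V,E,\sigma)$ with node set $V=[N]$, a simple undirected edge set $E$, and a sign $\sigma:E\to\{+,-\}$ on each edge. A signed triangle is a triangle with a fixed assignment of signs to its edges. For a given signed triangle $T$, a signed graph is signed triangle free if $T$ does not occur in it (no three nodes form a triangle whose edge signs agree with $T$ up to isomorphism). Bounded-degree signed graph model: the algorithm is given $N$ and an upper bound $d$ on the degrees of $G$, and may query $(v,i)\in[N]\times[d]$; the answer is the $i$-th neighbor $w$ of $v$ (in arbitrary order) together with the sign $\sigma(v,w)$, or an error symbol if $v$ has fewer than $i$ neighbors. A signed graph is $\epsilon$-far from a property $\mathcal P$ if at least $\epsilon dN$ edge modifications (addition, removal or sign switch) have to be made to obtain a signed graph on $[N]$ satisfying $\mathcal P$. A tester for $\mathcal P$ is a randomized algorithm that, given query access to $G$ and an error parameter $\epsilon>0$, accepts with probability at least $2/3$ if $G$ has $\mathcal P$, and rejects with probability at least $2/3$ if $G$ is $\epsilon$-far from having $\mathcal P$. It is one-sided if it always accepts graphs having $\mathcal P$. The query complexity is the number of queries made. -}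

module Defs where

open import Algebra.Definitions.RawMonoid using (sum)
open import Data.Bool using (Bool; true; false; if_then_else_)
open import Data.Bool.Properties using () renaming (_≟_ to _≟ᵇ_)
open import Data.Fin using (Fin; toℕ)
open import Data.Integer using (+_)
open import Data.List using (List; allFin; drop; head; length; mapMaybe)
open import Data.List.Relation.Binary.Permutation.Propositional using (_↭_)
open import Data.Maybe using (Maybe; just; nothing; map)
open import Data.Nat using (ℕ; suc; _⊔_; NonZero)
open import Data.Product using (_×_; _,_; ∃-syntax)
open import Data.Rational using (ℚ; 0ℚ; 1ℚ; Positive; _/_)
open import Data.Sign using (Sign)
open import Data.Sum using (_⊎_)
open import Data.Vec.Functional using (foldr)
open import Relation.Binary.PropositionalEquality using (_≡_; _≢_)
open import Relation.Nullary using (¬_; does)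
import Data.Nat as ℕ
import Data.Rational as ℚ

-- E and σ are bundled into one partial function: edge u v ≡ just s means
-- {u , v} ∈ E with σ(u , v) = s, and edge u v ≡ nothing means {u , v} ∉ E.
record SignedGraph (N : ℕ) : Set where
  field
    edge        : Fin N → Fin N → Maybe Sign
    edge-sym    : ∀ u v → edge u v ≡ edge v u
    edge-irrefl : ∀ v → edge v v ≡ nothing

open SignedGraph public

record SignedTriangle : Set where
  field
    sign₀₁ sign₀₂ sign₁₂ : Sign

open SignedTriangle public

-- All ordered triples are considered, so matching up to isomorphism is
-- included; the three nodes are distinct because there are no loops.
Occurs : SignedTriangle → ∀ {N} → SignedGraph N → Set
Occurs T G = ∃[ a ] ∃[ b ] ∃[ c ]
    edge G a b ≡ just (sign₀₁ T)
  × edge G a c ≡ just (sign₀₂ T)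
  × edge G b c ≡ just (sign₁₂ T)

Property : Set₁
Property = ∀ {N} → SignedGraph N → Set

TriangleFree : SignedTriangle → Property
TriangleFree T G = ¬ Occurs T G

infix 4 _≈_

_≈_ : ∀ {N} → SignedGraph N → SignedGraph N → Set
G ≈ H = ∀ x y → edge G x y ≡ edge H x y

-- The value at the single unordered pair {u , v} changes: from nothing to
-- just s (addition), from just s to nothing (removal), or from one sign to
-- the other (sign switch).
record Modification {N : ℕ} (G H : SignedGraph N) : Set where
  field
    u v       : Fin N
    changed   : edge G u v ≢ edge H u v
    unchanged : ∀ x y → ¬ ((x ≡ u × y ≡ v) ⊎ (x ≡ v × y ≡ u)) →
                edge G x y ≡ edge H x y

data Modifications {N : ℕ} : ℕ → SignedGraph N → SignedGraph N → Set where
  done : ∀ {G H} → G ≈ H → Modifications 0 G H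
  step : ∀ {m G H K} → Modification G H → Modifications m H K →
         Modifications (suc m) G K

toℚ : ℕ → ℚ
toℚ n = + n / 1

-- Modified graphs need not respect the degree bound d.
Far : Property → (d : ℕ) (ε : ℚ) → ∀ {N} → SignedGraph N → Set
Far P d ε {N} G =
  ∀ {m} {H : SignedGraph N} → Modifications m G H → P H →
  (ε ℚ.* toℚ d) ℚ.* toℚ N ℚ.≤ toℚ m

neighbours : ∀ {N} → SignedGraph N → Fin N → List (Fin N × Sign)
neighbours {N} G v = mapMaybe (λ w → map (w ,_) (edge G v w)) (allFin N)

degree : ∀ {N} → SignedGraph N → Fin N → ℕ
degree G v = length (neighbours G v)

record Input (N d : ℕ) : Set where
  field
    graph   : SignedGraph N
    bounded : ∀ v → degree graph v ℕ.≤ d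
    order   : Fin N → List (Fin N × Sign)
    order-↭ : ∀ v → order v ↭ neighbours graph v

open Input public

-- nothing is the error symbol.
Answer : ℕ → Set
Answer N = Maybe (Fin N × Sign)

answer : ∀ {N d} → Input N d → Fin N → Fin d → Answer N
answer I v i = head (drop (toℕ i) (order I v))

-- Adaptive randomized computations: choose n draws a fresh uniform element
-- of Fin n, and return true means accept.
data Computation (N d : ℕ) : Set where
  return : Bool → Computation N d
  query  : Fin N → Fin d → (Answer N → Computation N d) → Computation N d
  choose : (n : ℕ) .{{_ : NonZero n}} → (Fin n → Computation N d) →
           Computation N d

Pr[_returns_on_] : ∀ {N d} → Computation N d → Bool → Input N d → ℚ
Pr[ return b′ returns b on I ] = if does (b′ ≟ᵇ b) then 1ℚ else 0ℚ
Pr[ query v i k returns b on I ] = Pr[ k (answer I v i) returns b on I ]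
Pr[ choose n k returns b on I ] =
  (+ 1 / n) ℚ.* sum ℚ.+-0-rawMonoid (λ j → Pr[ k j returns b on I ])

-- The maximum number of queries over all random choices.
queries : ∀ {N d} → Computation N d → Input N d → ℕ
queries (return b)    I = 0
queries (query v i k) I = suc (queries (k (answer I v i)) I)
queries (choose n k)  I = foldr _⊔_ 0 (λ j → queries (k j) I)

Algorithm : Set
Algorithm = (N d : ℕ) .{{_ : NonZero N}} .{{_ : NonZero d}}
            (ε : ℚ) .{{_ : Positive ε}} → Computation N d

record IsTester (P : Property) (A : Algorithm) : Set where
  field
    accepts : ∀ N d .{{_ : NonZero N}} .{{_ : NonZero d}} ε .{{_ : Positive ε}}
              (I : Input N d) → P (graph I) →
              + 2 / 3 ℚ.≤ Pr[ A N d ε returns true on I ]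
    rejects : ∀ N d .{{_ : NonZero N}} .{{_ : NonZero d}} ε .{{_ : Positive ε}}
              (I : Input N d) → Far P d ε (graph I) →
              + 2 / 3 ℚ.≤ Pr[ A N d ε returns false on I ]

IsOneSided : Property → Algorithm → Set
IsOneSided P A =
  ∀ N d .{{_ : NonZero N}} .{{_ : NonZero d}} ε .{{_ : Positive ε}}
  (I : Input N d) → P (graph I) → Pr[ A N d ε returns true on I ] ≡ 1ℚ

-- At most f d / ε queries on every input, multiplied out to avoid division.
QueryComplexityAtMost : (ℕ → ℕ) → Algorithm → Set
QueryComplexityAtMost f A =
  ∀ N d .{{_ : NonZero N}} .{{_ : NonZero d}} ε .{{_ : Positive ε}}
  (I : Input N d) → toℚ (queries (A N d ε) I) ℚ.* ε ℚ.≤ toℚ (f d)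

{-# OPTIONS --safe #-}
module Submission where

-- Sample a node v and three slots i, j, k uniformly; query v's i-th neighbour b,
-- then b's j-th neighbour and v's k-th neighbour, and reject if the answers
-- close up to T. Deleting the pair {v , b} for every rejecting sample destroys
-- all copies of T, so an ε-far input has at least ε d N rejecting samples out of
-- N d³, i.e. a round rejects with probability p ≥ ε / d². Since
-- (1 - p)ⁿ (1 + n p) ≤ 1, n = ⌊3 d² / ε⌋ rounds suffice.

open import Defs
open import Algebra.Properties.Monoid.Sum using (sum-cong-≗)
open import Data.Bool using (Bool; true; false; if_then_else_)
open import Data.Bool.Properties using (if-cong; if-cong-else; if-eta; if-float)
open import Data.Fin using (Fin; zero; suc; toℕ; fromℕ<; combine; remQuot)
open import Data.Fin.Properties using (remQuot-combine; toℕ-fromℕ<; toℕ<n) renaming (_≟_ to _≟ᶠ_)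
open import Data.Integer using (+_; +[1+_])
open import Data.List using (List; _∷_; allFin; drop; head; mapMaybe)
open import Data.List.Membership.Propositional using (_∈_)
open import Data.List.Membership.Propositional.Properties using (∈-allFin)
open import Data.List.Relation.Binary.Permutation.Propositional using (↭-sym)
open import Data.List.Relation.Binary.Permutation.Propositional.Properties using (∈-resp-↭; ↭-length)
open import Data.List.Relation.Unary.Any using (here; there; index)
open import Data.List.Relation.Unary.Any.Properties using (map⁺; mapMaybe⁺)
open import Data.Maybe using (Maybe; just; nothing; maybe′) renaming (map to mapᴹ)
open import Data.Maybe.Properties using (≡-dec)
open import Data.Maybe.Relation.Unary.Any using (just) renaming (Any to Anyᴹ)
open import Data.Nat using (ℕ; zero; suc; _⊔_; _/_; _%_; NonZero; z≤n; s≤s; _+_; _*_; _^_; _≤_; _<_)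
open import Data.Nat.Coprimality using (1-coprimeTo) renaming (sym to coprime-sym)
open import Data.Product using (_×_; _,_; ∃-syntax; proj₁; proj₂; map₂)
open import Data.Rational using (ℚ; 0ℚ; 1ℚ; Positive; mkℚ; ↥_; ↧ₙ_)
open import Data.Sum using (_⊎_; inj₁; inj₂)
open import Data.Vec.Functional using (foldr)
open import Function using (_∘_; it; mk⇔)
open import Relation.Binary.PropositionalEquality
open import Relation.Nullary using (¬_; Dec; does; contradiction; _×-dec_; _⊎-dec_)
open import Relation.Nullary.Decidable using (dec-true; dec-false; from-yes; does-⇔)
import Algebra.Definitions.RawMonoid as RawMonoid
import Data.Integer as ℤ
import Data.Integer.Properties as ℤₚ
import Data.List.Relation.Unary.Any as Any
import Data.Nat.DivMod as ℕ
import Data.Nat.Properties as ℕ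
import Data.Nat.Solver as ℕ
import Data.Rational as ℚ
import Data.Rational.Properties as ℚ
import Data.Rational.Solver as ℚ
import Data.Rational.Unnormalised as ℚᵘ
import Data.Rational.Unnormalised.Properties as ℚᵘ
import Data.Sign.Properties as Sign

-- Natural numbers inside the rationals, and clearing the denominator of ε.

sumℚ : ∀ {n} → (Fin n → ℚ) → ℚ
sumℚ = RawMonoid.sum ℚ.+-0-rawMonoid

-- `toℚ n` is built by normalisation, which is stuck on a variable `n`. This form exposes numerator
-- and denominator, so that order and addition compute.
toℚ≡mkℚ : ∀ n → toℚ n ≡ mkℚ (+ n) 0 (coprime-sym (1-coprimeTo n))
toℚ≡mkℚ n = ℚ.normalize-coprime (coprime-sym (1-coprimeTo n))

toℚ-+ : ∀ m n → toℚ (m + n) ≡ toℚ m ℚ.+ toℚ n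
toℚ-+ m n = begin
  toℚ (m + n)
    -- Rational addition cross-multiplies by the denominators, both 1 here, which accounts for the
    -- factors `* 1`.
    ≡⟨ cong₂ (λ k l → (+ k ℤ.+ + l) ℚ./ 1) (ℕ.*-identityʳ m) (ℕ.*-identityʳ n) ⟨
  (+ (m * 1) ℤ.+ + (n * 1)) ℚ./ 1
    ≡⟨ cong (ℚ._/ 1) (cong₂ ℤ._+_ (ℤₚ.pos-* m 1) (ℤₚ.pos-* n 1)) ⟩
  (+ m ℤ.* + 1 ℤ.+ + n ℤ.* + 1) ℚ./ 1
    ≡⟨ cong₂ ℚ._+_ (toℚ≡mkℚ m) (toℚ≡mkℚ n) ⟨
  toℚ m ℚ.+ toℚ n ∎
  where open ≡-Reasoning

toℚ-* : ∀ m n → toℚ (m * n) ≡ toℚ m ℚ.* toℚ n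
toℚ-* zero    n = sym (ℚ.*-zeroˡ (toℚ n))
toℚ-* (suc m) n = begin
  toℚ (n + m * n)               ≡⟨ toℚ-+ n (m * n) ⟩
  toℚ n ℚ.+ toℚ (m * n)         ≡⟨ cong₂ ℚ._+_ (sym (ℚ.*-identityˡ (toℚ n))) (toℚ-* m n) ⟩
  1ℚ ℚ.* toℚ n ℚ.+ toℚ m ℚ.* toℚ n ≡⟨ ℚ.*-distribʳ-+ (toℚ n) 1ℚ (toℚ m) ⟨
  (1ℚ ℚ.+ toℚ m) ℚ.* toℚ n      ≡⟨ cong (ℚ._* toℚ n) (toℚ-+ 1 m) ⟨
  toℚ (suc m) ℚ.* toℚ n         ∎
  where open ≡-Reasoning

toℚ-mono : ∀ {m n} → m ≤ n → toℚ m ℚ.≤ toℚ n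
toℚ-mono {m} {n} m≤n = subst₂ ℚ._≤_ (sym (toℚ≡mkℚ m)) (sym (toℚ≡mkℚ n))
  (ℚ.*≤* (ℤₚ.*-monoʳ-≤-nonNeg (+ 1) (ℤ.+≤+ m≤n)))

toℚ-cancel : ∀ {m n} → toℚ m ℚ.≤ toℚ n → m ≤ n
toℚ-cancel {m} {n} p = ℤₚ.drop‿+≤+ (ℤₚ.*-cancelʳ-≤-pos (+ m) (+ n) (+ 1)
  (ℚ.drop-*≤* (subst₂ ℚ._≤_ (toℚ≡mkℚ m) (toℚ≡mkℚ n) p)))

toℚ-nonNegative : ∀ n → ℚ.NonNegative (toℚ n)
toℚ-nonNegative n = ℚ.normalize-nonNeg n 1

num : ℚ → ℕ
num ε = ℤ.∣ ↥ ε ∣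

ε*↧ε≡num : ∀ ε .{{_ : Positive ε}} → ε ℚ.* toℚ (↧ₙ ε) ≡ toℚ (num ε)
ε*↧ε≡num ε@(mkℚ +[1+ a ] b _) = ℚ.toℚᵘ-injective (begin
  ℚ.toℚᵘ (ε ℚ.* toℚ (suc b))                ≈⟨ ℚ.toℚᵘ-homo-* ε (toℚ (suc b)) ⟩
  ℚ.toℚᵘ ε ℚᵘ.* ℚ.toℚᵘ (toℚ (suc b))        ≈⟨ ℚᵘ.*-congˡ {ℚ.toℚᵘ ε} (ℚ.toℚᵘ-fromℚᵘ (+ suc b ℚᵘ./ 1)) ⟩
  ℚ.toℚᵘ ε ℚᵘ.* (+ suc b ℚᵘ./ 1)            ≈⟨ ℚᵘ.*≡* (trans (ℤₚ.*-identityʳ _)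
                                                 (cong (λ k → +[1+ a ] ℤ.* + k) (sym (ℕ.*-identityʳ (suc b))))) ⟩
  +[1+ a ] ℚᵘ./ 1                           ≈⟨ ℚ.toℚᵘ-fromℚᵘ _ ⟨
  ℚ.toℚᵘ (toℚ (suc a))                      ∎)
  where open import Relation.Binary.Reasoning.Setoid ℚᵘ.≃-setoid

module _ (ε : ℚ) .{{_ : Positive ε}} (x y : ℕ) where
  private
    instance
      ↧ε-positive : Positive (toℚ (↧ₙ ε))
      ↧ε-positive = ℚ.normalize-pos (↧ₙ ε) 1

    cross : (ε ℚ.* toℚ x) ℚ.* toℚ (↧ₙ ε) ≡ toℚ (num ε * x)
    cross = begin
      (ε ℚ.* toℚ x) ℚ.* toℚ (↧ₙ ε)  ≡⟨ solve 3 (λ e x b → (e :* x) :* b := (e :* b) :* x) refl ε (toℚ x) (toℚ (↧ₙ ε)) ⟩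
      (ε ℚ.* toℚ (↧ₙ ε)) ℚ.* toℚ x  ≡⟨ cong (ℚ._* toℚ x) (ε*↧ε≡num ε) ⟩
      toℚ (num ε) ℚ.* toℚ x         ≡⟨ toℚ-* (num ε) x ⟨
      toℚ (num ε * x)               ∎
      where open ≡-Reasoning
            open ℚ.+-*-Solver

  -- Multiplying by the denominator of `ε` leaves an inequality of natural numbers. In this form,
  -- distance and query bounds can be compared with a number of rounds defined by integer division.
  ε*x≤y⇒ : ε ℚ.* toℚ x ℚ.≤ toℚ y → num ε * x ≤ y * ↧ₙ ε
  ε*x≤y⇒ p = toℚ-cancel (subst₂ ℚ._≤_ cross (sym (toℚ-* y (↧ₙ ε)))
    (ℚ.*-monoʳ-≤-nonNeg (toℚ (↧ₙ ε)) {{toℚ-nonNegative (↧ₙ ε)}} p))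

  ε*x≤y⇐ : num ε * x ≤ y * ↧ₙ ε → ε ℚ.* toℚ x ℚ.≤ toℚ y
  ε*x≤y⇐ p = ℚ.*-cancelʳ-≤-pos (toℚ (↧ₙ ε))
    (subst₂ ℚ._≤_ (sym cross) (toℚ-* y (↧ₙ ε)) (toℚ-mono p))

-- Query answers and edges.

∈-mapMaybe⁺ : ∀ {A B : Set} (f : A → Maybe B) {xs x y} → x ∈ xs → f x ≡ just y → y ∈ mapMaybe f xs
∈-mapMaybe⁺ f x∈xs fx≡y = mapMaybe⁺ f _ (map⁺ (Any.map
  (λ { refl → subst (Anyᴹ (_ ≡_)) (sym fx≡y) (just refl) }) x∈xs))

∈-mapMaybe⁻ : ∀ {A B : Set} (f : A → Maybe B) xs {y} → y ∈ mapMaybe f xs → ∃[ x ] f x ≡ just y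
∈-mapMaybe⁻ f (x ∷ xs) p with f x in fx≡
∈-mapMaybe⁻ f (x ∷ xs) p           | nothing = ∈-mapMaybe⁻ f xs p
∈-mapMaybe⁻ f (x ∷ xs) (here refl) | just _  = x , fx≡
∈-mapMaybe⁻ f (x ∷ xs) (there p)   | just _  = ∈-mapMaybe⁻ f xs p

head-drop⁻ : ∀ {A : Set} (xs : List A) n {x} → head (drop n xs) ≡ just x → x ∈ xs
head-drop⁻ (x ∷ xs) zero    refl = here refl
head-drop⁻ (x ∷ xs) (suc n) eq   = there (head-drop⁻ xs n eq)

head-drop⁺ : ∀ {A : Set} {xs : List A} {x} (x∈xs : x ∈ xs) → head (drop (toℕ (index x∈xs)) xs) ≡ just x
head-drop⁺ (here refl)  = refl
head-drop⁺ (there x∈xs) = head-drop⁺ x∈xs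

module _ {N d} (I : Input N d) where

  answer⇒edge : ∀ v i {w s} → answer I v i ≡ just (w , s) → edge (graph I) v w ≡ just s
  answer⇒edge v i eq
    with u , p ← ∈-mapMaybe⁻ _ (allFin N) (∈-resp-↭ (order-↭ I v) (head-drop⁻ (order I v) (toℕ i) eq))
    with just s ← edge (graph I) v u in euv
    with refl ← p
    = euv

  edge⇒answer : ∀ {v w s} → edge (graph I) v w ≡ just s → ∃[ i ] answer I v i ≡ just (w , s)
  edge⇒answer {v} {w} {s} e = fromℕ< i<d ,
    trans (cong (λ n → head (drop n (order I v))) (toℕ-fromℕ< i<d)) (head-drop⁺ w∈order)
    where
    w∈order : (w , s) ∈ order I v
    w∈order = ∈-resp-↭ (↭-sym (order-↭ I v))
      (∈-mapMaybe⁺ (λ u → mapᴹ (u ,_) (edge (graph I) v u)) (∈-allFin w) (cong (mapᴹ (w ,_)) e))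

    -- The degree bound enters here: every neighbour sits at a position below `d`, so some legal
    -- query reveals it.
    i<d : toℕ (index w∈order) < d
    i<d = ℕ.<-≤-trans (toℕ<n (index w∈order))
      (subst (_≤ d) (sym (↭-length (order-↭ I v))) (bounded I v))

-- Samples and the triangles they detect.

Slots : ℕ → ℕ → Set
Slots N d = Fin N × Fin d × Fin d × Fin d

-- A whole sample is packed into one uniform index, so a round needs a single `choose` and its
-- rejection probability is a count divided by N d³.
decode : ∀ {N d} → Fin (N * (d * (d * d))) → Slots N d
decode {N} {d} = map₂ (map₂ (remQuot {d} d) ∘ remQuot {d} (d * d)) ∘ remQuot {N} (d * (d * d))

encode : ∀ {N d} → Slots N d → Fin (N * (d * (d * d)))
encode (v , i , j , k) = combine v (combine i (combine j k))

-- Makes `decode` surjective: every sample that detects a triangle is counted at some index.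
decode-encode : ∀ {N d} (t : Slots N d) → decode (encode t) ≡ t
decode-encode {N} {d} (v , i , j , k) = begin
  decode (encode (v , i , j , k))
    ≡⟨ cong (map₂ (map₂ (remQuot {d} d) ∘ remQuot {d} (d * d))) (remQuot-combine {N} v _) ⟩
  v , map₂ (remQuot {d} d) (remQuot {d} (d * d) (combine i (combine j k)))
    ≡⟨ cong (λ p → v , map₂ (remQuot {d} d) p) (remQuot-combine {d} i _) ⟩
  v , i , remQuot {d} d (combine j k)
    ≡⟨ cong (λ p → v , i , p) (remQuot-combine {d} j k) ⟩
  v , i , j , k ∎
  where open ≡-Reasoning

-- For a triangle a, b, c the answers `α`, `β`, `γ` stand for the steps a to b, b to c and a to c;
-- hence the order of the signs. The sign equations exclude error symbols, so the last equation
-- compares two actual nodes.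
Matches : SignedTriangle → ∀ {N} → (α β γ : Answer N) → Set
Matches T α β γ = mapᴹ proj₂ α ≡ just (sign₀₁ T) × mapᴹ proj₂ β ≡ just (sign₁₂ T)
                × mapᴹ proj₂ γ ≡ just (sign₀₂ T) × mapᴹ proj₁ β ≡ mapᴹ proj₁ γ

matches? : ∀ T {N} (α β γ : Answer N) → Dec (Matches T α β γ)
matches? T α β γ = ≡-dec Sign._≟_ _ _ ×-dec ≡-dec Sign._≟_ _ _
             ×-dec ≡-dec Sign._≟_ _ _ ×-dec ≡-dec _≟ᶠ_ _ _

-- If α is the error symbol, the second query is a dummy at v.
endpoint : ∀ {N} → Fin N → Answer N → Fin N
endpoint v = maybe′ proj₁ v

Detects : SignedTriangle → ∀ {N d} → Input N d → Slots N d → Set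
Detects T I (v , i , j , k) =
  Matches T (answer I v i) (answer I (endpoint v (answer I v i)) j) (answer I v k)

detects? : ∀ T {N d} (I : Input N d) t → Dec (Detects T I t)
detects? T I (v , i , j , k) =
  matches? T (answer I v i) (answer I (endpoint v (answer I v i)) j) (answer I v k)

detectedPair : ∀ {N d} → Input N d → Slots N d → Fin N × Fin N
detectedPair I (v , i , _) = v , endpoint v (answer I v i)

-- Soundness of a round, the source of one-sided error: the three answers are genuine edges, and the
-- two that should meet name the same third node.
detects⇒occurs : ∀ T {N d} (I : Input N d) t → Detects T I t → Occurs T (graph I)
detects⇒occurs T I (v , i , j , k) m
  with answer I v i in α≡ | m
... | just (b , _) | refl , m′
  with answer I b j in β≡ | answer I v k in γ≡ | m′
... | just (c , _) | just (_ , _) | refl , refl , refl =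
  v , b , c , answer⇒edge I v i α≡ , answer⇒edge I v k γ≡ , answer⇒edge I b j β≡

-- Besides completeness, this records which pair the detecting sample singles out: every copy of `T`
-- loses its edge a b once the pairs of all detecting samples are deleted.
occurs⇒detects : ∀ T {N d} (I : Input N d) {a b c} →
  edge (graph I) a b ≡ just (sign₀₁ T) → edge (graph I) a c ≡ just (sign₀₂ T) →
  edge (graph I) b c ≡ just (sign₁₂ T) →
  ∃[ t ] Detects T I t × detectedPair I t ≡ (a , b)
occurs⇒detects T I {a} {b} ab ac bc
  with i , α≡ ← edge⇒answer I ab | j , β≡ ← edge⇒answer I bc | k , γ≡ ← edge⇒answer I ac
  = (a , i , j , k) , lemma
  where
  lemma : Detects T I (a , i , j , k) × detectedPair I (a , i , j , k) ≡ (a , b)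
  lemma rewrite α≡ | β≡ | γ≡ = (refl , refl , refl , refl) , refl

-- Deleting edges one pair at a time.

SamePair : ∀ {N} (u v x y : Fin N) → Set
SamePair u v x y = (x ≡ u × y ≡ v) ⊎ (x ≡ v × y ≡ u)

samePair? : ∀ {N} (u v x y : Fin N) → Dec (SamePair u v x y)
samePair? u v x y = (x ≟ᶠ u ×-dec y ≟ᶠ v) ⊎-dec (x ≟ᶠ v ×-dec y ≟ᶠ u)

deleteEdge : ∀ {N} → SignedGraph N → (u v : Fin N) → SignedGraph N
deleteEdge G u v = record
  { edge        = λ x y → if does (samePair? u v x y) then nothing else edge G x y
  ; edge-sym    = λ x y → cong₂ (if_then nothing else_)
      (does-⇔ (mk⇔ flip flip) (samePair? u v x y) (samePair? u v y x)) (edge-sym G x y)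
  ; edge-irrefl = λ x → trans (if-cong-else (does (samePair? u v x x)) (edge-irrefl G x))
                              (if-eta (does (samePair? u v x x)))
  }
  where
  flip : ∀ {x y} → SamePair u v x y → SamePair u v y x
  flip (inj₁ (p , q)) = inj₂ (q , p)
  flip (inj₂ (p , q)) = inj₁ (q , p)

deleteEdge-deleted : ∀ {N} (G : SignedGraph N) u v → edge (deleteEdge G u v) u v ≡ nothing
deleteEdge-deleted G u v = if-cong (dec-true (samePair? u v u v) (inj₁ (refl , refl)))

deleteEdge-other : ∀ {N} (G : SignedGraph N) u v {x y} → ¬ SamePair u v x y →
                   edge G x y ≡ edge (deleteEdge G u v) x y
deleteEdge-other G u v ¬p = sym (if-cong (dec-false (samePair? u v _ _) ¬p))

infix 4 _⊆_

_⊆_ : ∀ {N} → SignedGraph N → SignedGraph N → Set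
H ⊆ G = ∀ {x y s} → edge H x y ≡ just s → edge G x y ≡ just s

⊆-nothing : ∀ {N} {G H : SignedGraph N} {x y} → H ⊆ G → edge G x y ≡ nothing → edge H x y ≡ nothing
⊆-nothing {H = H} {x} {y} H⊆G eq with edge H x y in h
... | nothing = refl
... | just s  with () ← trans (sym (H⊆G h)) eq

deleteEdge-⊆ : ∀ {N} (G : SignedGraph N) u v → deleteEdge G u v ⊆ G
deleteEdge-⊆ G u v {x} {y} eq with does (samePair? u v x y) | eq
... | false | eq′ = eq′
... | true  | ()

count : ∀ {n} → (Fin n → Bool) → ℕ
count {zero}  f = 0
count {suc n} f = (if f zero then 1 else 0) + count (f ∘ suc)

count≤n : ∀ {n} (f : Fin n → Bool) → count f ≤ n
count≤n {zero}  f = z≤n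
count≤n {suc n} f with f zero
... | true  = s≤s (count≤n (f ∘ suc))
... | false = ℕ.m≤n⇒m≤1+n (count≤n (f ∘ suc))

-- Several indices may name the same pair, so `size` is only bounded by the count. The inclusion
-- `result ⊆ G` preserves signs, so no new copy of a signed triangle can arise.
record Deletion {N n} (G : SignedGraph N) (f : Fin n → Bool) (e : Fin n → Fin N × Fin N) : Set where
  field
    {size}        : ℕ
    {result}      : SignedGraph N
    modifications : Modifications size G result
    size≤count    : size ≤ count f
    result⊆G      : result ⊆ G
    deleted       : ∀ j → f j ≡ true → edge result (proj₁ (e j)) (proj₂ (e j)) ≡ nothing

deleteEdges : ∀ {N n} (G : SignedGraph N) (f : Fin n → Bool) (e : Fin n → Fin N × Fin N) → Deletion G f e
deleteEdges {n = zero} G f e = record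
  { result        = G
  ; modifications = done λ _ _ → refl
  ; size≤count    = z≤n
  ; result⊆G      = λ eq → eq
  ; deleted       = λ ()
  }
deleteEdges {n = suc n} G f e with f zero in f₀ | edge G (proj₁ (e zero)) (proj₂ (e zero)) in e₀
... | false | _ = record
  { modifications = modifications
  ; size≤count    = subst (λ b → size ≤ (if b then 1 else 0) + count (f ∘ suc)) (sym f₀) size≤count
  ; result⊆G      = result⊆G
  ; deleted       = λ { zero f₀′ → contradiction (trans (sym f₀′) f₀) λ () ; (suc j) → deleted j }
  }
  where open Deletion (deleteEdges G (f ∘ suc) (e ∘ suc))
-- The pair is already absent. A `Modification` must change its pair, so none is made: the count
-- grows while `size` stays.
... | true | nothing = record
  { modifications = modifications
  ; size≤count    = subst (λ b → size ≤ (if b then 1 else 0) + count (f ∘ suc)) (sym f₀) (ℕ.m≤n⇒m≤1+n size≤count)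
  ; result⊆G      = result⊆G
  ; deleted       = λ { zero _ → ⊆-nothing {G = G} {H = result} result⊆G e₀ ; (suc j) → deleted j }
  }
  where open Deletion (deleteEdges G (f ∘ suc) (e ∘ suc))
-- The pair is removed before the recursive call; the inclusion of the final graph in
-- `deleteEdge G u v` keeps it absent.
... | true | just _ = record
  { modifications = step modification modifications
  ; size≤count    = subst (λ b → suc size ≤ (if b then 1 else 0) + count (f ∘ suc)) (sym f₀) (s≤s size≤count)
  ; result⊆G      = λ eq → deleteEdge-⊆ G u v (result⊆G eq)
  ; deleted       = λ { zero _ → ⊆-nothing {G = deleteEdge G u v} {H = result} result⊆G (deleteEdge-deleted G u v)
                      ; (suc j) → deleted j }
  }
  where
  u = proj₁ (e zero)
  v = proj₂ (e zero)
  open Deletion (deleteEdges (deleteEdge G u v) (f ∘ suc) (e ∘ suc))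
  modification : Modification G (deleteEdge G u v)
  modification = record
    { u         = u
    ; v         = v
    ; changed   = λ eq → contradiction (trans (sym e₀) (trans eq (deleteEdge-deleted G u v))) λ ()
    ; unchanged = λ x y → deleteEdge-other G u v
    }

-- Rejecting samples on far and on triangle-free inputs.

hits : ∀ T {N d} → Input N d → Fin (N * (d * (d * d))) → Bool
hits T I x = does (detects? T I (decode x))

-- A copy of `T` surviving all deletions would also be a copy in the input, hence detected by a
-- sample whose pair, an edge of that copy, has been deleted. So farness bounds the number of
-- deletions, and with it the number of hits, from below.
far⇒manyHits : ∀ T {N d} ε (I : Input N d) → Far (TriangleFree T) d ε (graph I) →
               (ε ℚ.* toℚ d) ℚ.* toℚ N ℚ.≤ toℚ (count (hits T I))
far⇒manyHits T {N} {d} ε I far = ℚ.≤-trans (far modifications free) (toℚ-mono size≤count)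
  where
  open Deletion (deleteEdges (graph I) (hits T I) (detectedPair I ∘ decode))
  free : TriangleFree T result
  free (a , b , c , ab , ac , bc)
    with t , detected , pair ← occurs⇒detects T I (result⊆G ab) (result⊆G ac) (result⊆G bc)
    = contradiction (trans (sym ab) ab≡nothing) λ ()
    where
    t≡ = sym (decode-encode t)
    ab≡nothing : edge result a b ≡ nothing
    ab≡nothing = subst (λ p → edge result (proj₁ p) (proj₂ p) ≡ nothing)
      (trans (cong (detectedPair I) (decode-encode t)) pair)
      (deleted (encode t) (dec-true (detects? T I (decode (encode t))) (subst (Detects T I) t≡ detected)))

free⇒noHits : ∀ T {N d} (I : Input N d) → TriangleFree T (graph I) → ∀ x → hits T I x ≡ false
free⇒noHits T I free x = dec-false (detects? T I (decode x)) (free ∘ detects⇒occurs T I (decode x))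

-- Averaging over one round, and decay over many rounds.

sumℚ-if : ∀ {n} (f : Fin n → Bool) q →
          sumℚ (λ j → if f j then 1ℚ else q) ≡ toℚ (count f) ℚ.* (1ℚ ℚ.- q) ℚ.+ toℚ n ℚ.* q
sumℚ-if {zero}  f q = solve 1 (λ q → con 0ℚ := con 0ℚ :* (con 1ℚ :- q) :+ con 0ℚ :* q) refl q
  where open ℚ.+-*-Solver
sumℚ-if {suc n} f q with f zero
... | true = begin
  1ℚ ℚ.+ sumℚ (λ j → if f (suc j) then 1ℚ else q)
    ≡⟨ cong (1ℚ ℚ.+_) (sumℚ-if (f ∘ suc) q) ⟩
  1ℚ ℚ.+ (c ℚ.* (1ℚ ℚ.- q) ℚ.+ toℚ n ℚ.* q)
    ≡⟨ solve 3 (λ c n q → con 1ℚ :+ (c :* (con 1ℚ :- q) :+ n :* q) :=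
                          (con 1ℚ :+ c) :* (con 1ℚ :- q) :+ (con 1ℚ :+ n) :* q) refl c (toℚ n) q ⟩
  (1ℚ ℚ.+ c) ℚ.* (1ℚ ℚ.- q) ℚ.+ (1ℚ ℚ.+ toℚ n) ℚ.* q
    ≡⟨ cong₂ (λ k m → k ℚ.* (1ℚ ℚ.- q) ℚ.+ m ℚ.* q) (toℚ-+ 1 (count (f ∘ suc))) (toℚ-+ 1 n) ⟨
  toℚ (suc (count (f ∘ suc))) ℚ.* (1ℚ ℚ.- q) ℚ.+ toℚ (suc n) ℚ.* q ∎
  where
  c = toℚ (count (f ∘ suc))
  open ≡-Reasoning
  open ℚ.+-*-Solver
... | false = begin
  q ℚ.+ sumℚ (λ j → if f (suc j) then 1ℚ else q)
    ≡⟨ cong (q ℚ.+_) (sumℚ-if (f ∘ suc) q) ⟩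
  q ℚ.+ (c ℚ.* (1ℚ ℚ.- q) ℚ.+ toℚ n ℚ.* q)
    ≡⟨ solve 3 (λ c n q → q :+ (c :* (con 1ℚ :- q) :+ n :* q) :=
                          c :* (con 1ℚ :- q) :+ (con 1ℚ :+ n) :* q) refl c (toℚ n) q ⟩
  c ℚ.* (1ℚ ℚ.- q) ℚ.+ (1ℚ ℚ.+ toℚ n) ℚ.* q
    ≡⟨ cong (λ m → c ℚ.* (1ℚ ℚ.- q) ℚ.+ m ℚ.* q) (toℚ-+ 1 n) ⟨
  c ℚ.* (1ℚ ℚ.- q) ℚ.+ toℚ (suc n) ℚ.* q ∎
  where
  c = toℚ (count (f ∘ suc))
  open ≡-Reasoning
  open ℚ.+-*-Solver

1/n*n≡1 : ∀ n .{{_ : NonZero n}} → (+ 1 ℚ./ n) ℚ.* toℚ n ≡ 1ℚ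
1/n*n≡1 (suc n) = trans (cong (ℚ._* toℚ (suc n)) (ℚ.normalize-coprime (1-coprimeTo (suc n))))
                        (ε*↧ε≡num (mkℚ (+ 1) n (1-coprimeTo (suc n))))

*-nonNegative : ∀ {p q} → 0ℚ ℚ.≤ p → 0ℚ ℚ.≤ q → 0ℚ ℚ.≤ p ℚ.* q
*-nonNegative {p} {q} 0≤p 0≤q = ℚ.nonNegative⁻¹ (p ℚ.* q)
  {{ℚ.nonNeg*nonNeg⇒nonNeg p {{ℚ.nonNegative 0≤p}} q {{ℚ.nonNegative 0≤q}}}}

p≤q⇒0≤q-p : ∀ {p q} → p ℚ.≤ q → 0ℚ ℚ.≤ q ℚ.- p
p≤q⇒0≤q-p {p} {q} p≤q = subst (ℚ._≤ q ℚ.- p) (ℚ.+-inverseʳ p) (ℚ.+-monoˡ-≤ (ℚ.- p) p≤q)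

-- The reciprocal form (1 - p)ⁿ ≤ 1 / (1 + n p) of Bernoulli's inequality.
module _ {p : ℚ} (0≤p : 0ℚ ℚ.≤ p) (p≤1 : p ℚ.≤ 1ℚ)
         (e : ℕ → ℚ) (e-zero : e 0 ≡ 1ℚ) (e-suc : ∀ n → e (suc n) ≡ (1ℚ ℚ.- p) ℚ.* e n) where

  decay-nonNegative : ∀ n → 0ℚ ℚ.≤ e n
  decay-nonNegative zero    = subst (0ℚ ℚ.≤_) (sym e-zero) (from-yes (0ℚ ℚ.≤? 1ℚ))
  decay-nonNegative (suc n) = subst (0ℚ ℚ.≤_) (sym (e-suc n))
    (*-nonNegative (p≤q⇒0≤q-p p≤1) (decay-nonNegative n))

  decay-bound : ∀ n → e n ℚ.* (1ℚ ℚ.+ toℚ n ℚ.* p) ℚ.≤ 1ℚ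
  decay-bound zero = ℚ.≤-reflexive (begin
    e 0 ℚ.* (1ℚ ℚ.+ 0ℚ ℚ.* p)  ≡⟨ cong (ℚ._* (1ℚ ℚ.+ 0ℚ ℚ.* p)) e-zero ⟩
    1ℚ ℚ.* (1ℚ ℚ.+ 0ℚ ℚ.* p)   ≡⟨ solve 1 (λ p → con 1ℚ :* (con 1ℚ :+ con 0ℚ :* p) := con 1ℚ) refl p ⟩
    1ℚ                         ∎)
    where open ≡-Reasoning
          open ℚ.+-*-Solver
  decay-bound (suc n) = begin
    e (suc n) ℚ.* (1ℚ ℚ.+ toℚ (suc n) ℚ.* p)
      ≡⟨ cong₂ (λ a k → a ℚ.* (1ℚ ℚ.+ k ℚ.* p)) (e-suc n) (toℚ-+ 1 n) ⟩
    (1ℚ ℚ.- p) ℚ.* e n ℚ.* (1ℚ ℚ.+ (1ℚ ℚ.+ toℚ n) ℚ.* p)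
      ≡⟨ solve 3 (λ p a n → (con 1ℚ :- p) :* a :* (con 1ℚ :+ (con 1ℚ :+ n) :* p) :=
                            a :* (con 1ℚ :+ n :* p) :- a :* ((con 1ℚ :+ n) :* (p :* p))) refl p (e n) (toℚ n) ⟩
    e n ℚ.* (1ℚ ℚ.+ toℚ n ℚ.* p) ℚ.- e n ℚ.* ((1ℚ ℚ.+ toℚ n) ℚ.* (p ℚ.* p))
      ≤⟨ ℚ.+-mono-≤ (decay-bound n) (ℚ.neg-antimono-≤ (*-nonNegative (decay-nonNegative n)
           (*-nonNegative
             (subst (0ℚ ℚ.≤_) (toℚ-+ 1 n) (ℚ.nonNegative⁻¹ (toℚ (suc n)) {{toℚ-nonNegative (suc n)}}))
             (*-nonNegative 0≤p 0≤p)))) ⟩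
    1ℚ ℚ.- 0ℚ
      ≡⟨⟩
    1ℚ ∎
    where open ℚ.≤-Reasoning
          open ℚ.+-*-Solver

  decay≤⅓ : ∀ n → toℚ 2 ℚ.≤ toℚ n ℚ.* p → e n ℚ.≤ + 1 ℚ./ 3
  decay≤⅓ n 2≤np = ℚ.*-cancelʳ-≤-pos (toℚ 3) (begin
    -- `toℚ 3` evaluates to `1ℚ ℚ.+ toℚ 2`, which fits the factor 1 + n p with n p at least 2.
    e n ℚ.* (1ℚ ℚ.+ toℚ 2)
      ≤⟨ ℚ.*-monoˡ-≤-nonNeg (e n) {{ℚ.nonNegative (decay-nonNegative n)}} (ℚ.+-monoʳ-≤ 1ℚ 2≤np) ⟩
    e n ℚ.* (1ℚ ℚ.+ toℚ n ℚ.* p)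
      ≤⟨ decay-bound n ⟩
    1ℚ ∎)
    where open ℚ.≤-Reasoning

-- The sampling algorithm and its probabilities.

probe : SignedTriangle → ∀ {N d} → Slots N d → Computation N d → Computation N d
probe T (v , i , j , k) K =
  query v i λ α → query (endpoint v α) j λ β → query v k λ γ →
  if does (matches? T α β γ) then return false else K

slots≢0 : ∀ {N d} .{{_ : NonZero N}} .{{_ : NonZero d}} → NonZero (N * (d * (d * d)))
slots≢0 {N} {d} = ℕ.m*n≢0 N _ {{it}} {{ℕ.m*n≢0 d (d * d) {{it}} {{ℕ.m*n≢0 d d}}}}

sampler : SignedTriangle → ∀ N d .{{_ : NonZero N}} .{{_ : NonZero d}} → ℕ → Computation N d
sampler T N d zero    = return true
sampler T N d (suc n) = choose (N * (d * (d * d))) {{slots≢0}} λ x → probe T (decode x) (sampler T N d n)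

module _ (T : SignedTriangle) {N d} .{{_ : NonZero N}} .{{_ : NonZero d}} (I : Input N d) where
  private
    M h : ℕ
    M = N * (d * (d * d))
    h = count (hits T I)

    r p : ℚ
    r = (+ 1 ℚ./ M) {{slots≢0}}
    p = r ℚ.* toℚ h

    r*M≡1 : r ℚ.* toℚ M ≡ 1ℚ
    r*M≡1 = 1/n*n≡1 M {{slots≢0}}

    instance
      r-nonNegative : ℚ.NonNegative r
      r-nonNegative = ℚ.normalize-nonNeg 1 M {{slots≢0}}

    accept reject : ℕ → ℚ
    accept n = Pr[ sampler T N d n returns true on I ]
    reject n = Pr[ sampler T N d n returns false on I ]

  free⇒accepts : TriangleFree T (graph I) → ∀ n → accept n ≡ 1ℚ
  free⇒accepts free zero    = refl
  free⇒accepts free (suc n) = begin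
    -- Running `probe` on `I` computes to this conditional, since `probe` and `detects?` apply
    -- `matches?` to the same answers.
    r ℚ.* sumℚ (λ x → Pr[ if hits T I x then return false else sampler T N d n returns true on I ])
      ≡⟨ cong (r ℚ.*_) (sum-cong-≗ ℚ.+-0-monoid λ x → trans
           (cong (λ b → Pr[ if b then return false else sampler T N d n returns true on I ])
                 (free⇒noHits T I free x))
           (free⇒accepts free n)) ⟩
    r ℚ.* sumℚ {M} (λ _ → 1ℚ)
      -- The constant sum is read as a conditional with both branches 1; the factor `1ℚ ℚ.- 1ℚ` then
      -- removes the count.
      ≡⟨ cong (r ℚ.*_) (sumℚ-if {M} (λ _ → true) 1ℚ) ⟩
    r ℚ.* (toℚ (count {M} (λ _ → true)) ℚ.* (1ℚ ℚ.- 1ℚ) ℚ.+ toℚ M ℚ.* 1ℚ)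
      ≡⟨ solve 3 (λ r c m → r :* (c :* (con 1ℚ :- con 1ℚ) :+ m :* con 1ℚ) := r :* m)
           refl r (toℚ (count {M} (λ _ → true))) (toℚ M) ⟩
    r ℚ.* toℚ M
      ≡⟨ r*M≡1 ⟩
    1ℚ ∎
    where open ≡-Reasoning
          open ℚ.+-*-Solver

  -- Stated for the complement because survival is multiplicative: the first round must miss, with
  -- probability 1 - p, and the independent remaining rounds must not reject either.
  reject-suc : ∀ n → 1ℚ ℚ.- reject (suc n) ≡ (1ℚ ℚ.- p) ℚ.* (1ℚ ℚ.- reject n)
  reject-suc n = begin
    1ℚ ℚ.- r ℚ.* sumℚ (λ x → Pr[ if hits T I x then return false else sampler T N d n returns false on I ])
      ≡⟨ cong (λ s → 1ℚ ℚ.- r ℚ.* s) (sum-cong-≗ ℚ.+-0-monoid λ x →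
           if-float (λ C → Pr[ C returns false on I ]) (hits T I x)) ⟩
    1ℚ ℚ.- r ℚ.* sumℚ (λ x → if hits T I x then 1ℚ else q)
      ≡⟨ cong (λ s → 1ℚ ℚ.- r ℚ.* s) (sumℚ-if (hits T I) q) ⟩
    1ℚ ℚ.- r ℚ.* (toℚ h ℚ.* (1ℚ ℚ.- q) ℚ.+ toℚ M ℚ.* q)
      ≡⟨ solve 4 (λ r h m q → con 1ℚ :- r :* (h :* (con 1ℚ :- q) :+ m :* q) :=
                              con 1ℚ :- (r :* h :* (con 1ℚ :- q) :+ r :* m :* q)) refl r (toℚ h) (toℚ M) q ⟩
    1ℚ ℚ.- (p ℚ.* (1ℚ ℚ.- q) ℚ.+ r ℚ.* toℚ M ℚ.* q)
      ≡⟨ cong (λ s → 1ℚ ℚ.- (p ℚ.* (1ℚ ℚ.- q) ℚ.+ s ℚ.* q)) r*M≡1 ⟩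
    1ℚ ℚ.- (p ℚ.* (1ℚ ℚ.- q) ℚ.+ 1ℚ ℚ.* q)
      ≡⟨ solve 2 (λ p q → con 1ℚ :- (p :* (con 1ℚ :- q) :+ con 1ℚ :* q) :=
                              (con 1ℚ :- p) :* (con 1ℚ :- q)) refl p q ⟩
    (1ℚ ℚ.- p) ℚ.* (1ℚ ℚ.- q) ∎
    where
    q = reject n
    open ≡-Reasoning
    open ℚ.+-*-Solver

  -- Dividing the hypothesis by N d³ gives n p ≥ 2, so the probability of not rejecting is at most
  -- 1/3.
  manyHits⇒rejects : ∀ n → 2 * (N * (d * (d * d))) ≤ n * count (hits T I) → + 2 ℚ./ 3 ℚ.≤ reject n
  manyHits⇒rejects n 2M≤nh = begin
    1ℚ ℚ.- + 1 ℚ./ 3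
      ≤⟨ ℚ.+-monoʳ-≤ 1ℚ (ℚ.neg-antimono-≤
           -- The abstract decaying sequence is the survival probability; `reject-suc` is exactly
           -- its recurrence.
           (decay≤⅓ 0≤p p≤1 (λ n → 1ℚ ℚ.- reject n) refl reject-suc n 2≤np)) ⟩
    1ℚ ℚ.- (1ℚ ℚ.- reject n)
      ≡⟨ solve 1 (λ q → con 1ℚ :- (con 1ℚ :- q) := q) refl (reject n) ⟩
    reject n ∎
    where
    open ℚ.≤-Reasoning
    open ℚ.+-*-Solver
    0≤p : 0ℚ ℚ.≤ p
    0≤p = *-nonNegative (ℚ.nonNegative⁻¹ r) (ℚ.nonNegative⁻¹ (toℚ h) {{toℚ-nonNegative h}})
    p≤1 : p ℚ.≤ 1ℚ
    p≤1 = subst (p ℚ.≤_) r*M≡1 (ℚ.*-monoˡ-≤-nonNeg r (toℚ-mono (count≤n (hits T I))))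
    2≤np : toℚ 2 ℚ.≤ toℚ n ℚ.* p
    2≤np = begin
      toℚ 2                           ≡⟨ ℚ.*-identityʳ (toℚ 2) ⟨
      toℚ 2 ℚ.* 1ℚ                    ≡⟨ cong (toℚ 2 ℚ.*_) r*M≡1 ⟨
      toℚ 2 ℚ.* (r ℚ.* toℚ M)         ≡⟨ solve 3 (λ t r m → t :* (r :* m) := r :* (t :* m)) refl (toℚ 2) r (toℚ M) ⟩
      r ℚ.* (toℚ 2 ℚ.* toℚ M)         ≡⟨ cong (r ℚ.*_) (toℚ-* 2 M) ⟨
      r ℚ.* toℚ (2 * M)               ≤⟨ ℚ.*-monoˡ-≤-nonNeg r (toℚ-mono 2M≤nh) ⟩
      r ℚ.* toℚ (n * h)               ≡⟨ cong (r ℚ.*_) (toℚ-* n h) ⟩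
      r ℚ.* (toℚ n ℚ.* toℚ h)         ≡⟨ solve 3 (λ r n h → r :* (n :* h) := n :* (r :* h)) refl r (toℚ n) (toℚ h) ⟩
      toℚ n ℚ.* p                     ∎

-- Query count and number of rounds.

foldr-⊔-≤ : ∀ {n m} (f : Fin n → ℕ) → (∀ j → f j ≤ m) → foldr _⊔_ 0 f ≤ m
foldr-⊔-≤ {zero}  f f≤m = z≤n
foldr-⊔-≤ {suc n} f f≤m = ℕ.⊔-lub (f≤m zero) (foldr-⊔-≤ (f ∘ suc) (f≤m ∘ suc))

queries-sampler : ∀ T {N d} .{{_ : NonZero N}} .{{_ : NonZero d}} (I : Input N d) n →
                  queries (sampler T N d n) I ≤ n * 3
queries-sampler T I zero = z≤n
queries-sampler T {N} {d} I (suc n) = foldr-⊔-≤ _ λ x → s≤s (s≤s (s≤s (after (hits T I x))))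
  where
  after : ∀ b → queries (if b then return false else sampler T N d n) I ≤ n * 3
  after true  = z≤n
  after false = queries-sampler T I n

num≢0 : ∀ ε .{{_ : Positive ε}} → NonZero (num ε)
num≢0 (mkℚ +[1+ _ ] _ _) = _

-- Rounding down keeps the query bound valid for every positive `ε`, however large. For ε > 3 d²
-- there are no rounds and the algorithm just accepts.
rounds : ℕ → (ε : ℚ) .{{_ : Positive ε}} → ℕ
rounds d ε = (3 * (d * d * ↧ₙ ε) / num ε) {{num≢0 ε}}

-- With ε = A / B, the hypothesis `far` says h ≥ ε d N, and about 2 d² / ε rounds would give n h ≥ 2
-- N d³. The third d² / ε in `rounds` pays for rounding.
enoughRounds : ∀ N d .{{_ : NonZero N}} .{{_ : NonZero d}} ε .{{_ : Positive ε}} h →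
  h ≤ N * (d * (d * d)) → num ε * (d * N) ≤ h * ↧ₙ ε → 2 * (N * (d * (d * d))) ≤ rounds d ε * h
enoughRounds N d ε h h≤M far = ℕ.*-cancelʳ-≤ _ _ B (begin
  2 * (N * (d * (d * d))) * B   ≡⟨ solve 3 (λ N d B → con 2 :* (N :* (d :* (d :* d))) :* B :=
                                                      con 2 :* (d :* d :* B) :* (d :* N)) refl N d B ⟩
  2 * X * (d * N)               ≤⟨ ℕ.*-monoˡ-≤ (d * N) 2X≤nA ⟩
  n * A * (d * N)               ≡⟨ ℕ.*-assoc n A (d * N) ⟩
  n * (A * (d * N))             ≤⟨ ℕ.*-monoʳ-≤ n far ⟩
  n * (h * B)                   ≡⟨ ℕ.*-assoc n h B ⟨
  n * h * B                     ∎)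
  where
  open ℕ.≤-Reasoning
  open ℕ.+-*-Solver
  instance
    _ = num≢0 ε
    _ = ℕ.m*n≢0 d N
  A = num ε
  B = ↧ₙ ε
  X = d * d * B
  n = rounds d ε

  -- Far inputs exist only when ε ≤ d², so rounding 3 d² / ε down loses at most a third.
  A≤X : A ≤ X
  A≤X = ℕ.*-cancelʳ-≤ A X (d * N) (begin
    A * (d * N)              ≤⟨ far ⟩
    h * B                    ≤⟨ ℕ.*-monoˡ-≤ B h≤M ⟩
    N * (d * (d * d)) * B    ≡⟨ solve 3 (λ N d B → N :* (d :* (d :* d)) :* B :=
                                                 d :* d :* B :* (d :* N)) refl N d B ⟩
    X * (d * N)              ∎)

  2X≤nA : 2 * X ≤ n * A
  -- Adding X to both sides gives 3 X on the left, which is n A plus a remainder below A, hence at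
  -- most X.
  2X≤nA = ℕ.+-cancelˡ-≤ X _ _ (begin
    3 * X                    ≡⟨ ℕ.m≡m%n+[m/n]*n (3 * X) A ⟩
    3 * X % A + n * A        ≤⟨ ℕ.+-monoˡ-≤ (n * A) (ℕ.≤-trans (ℕ.<⇒≤ (ℕ.m%n<n (3 * X) A)) A≤X) ⟩
    X + n * A                ∎)

theorem5 : ∀ (T : SignedTriangle) →
    ∃[ A ] IsTester (TriangleFree T) A
    × IsOneSided (TriangleFree T) A
    × (∃[ c ] ∃[ k ] QueryComplexityAtMost (λ d → c * d ^ k) A)
-- Three queries in each of at most 3 d² / ε rounds give the constant 9 and the exponent 2.
theorem5 T = A , record { accepts = accepts ; rejects = rejects } , oneSided , 9 , 2 , complexity
  where
  A : Algorithm
  A N d ε = sampler T N d (rounds d ε)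

  oneSided : IsOneSided (TriangleFree T) A
  oneSided N d ε I free = free⇒accepts T I free (rounds d ε)

  accepts : ∀ N d .{{_ : NonZero N}} .{{_ : NonZero d}} ε .{{_ : Positive ε}} (I : Input N d) →
            TriangleFree T (graph I) → + 2 ℚ./ 3 ℚ.≤ Pr[ A N d ε returns true on I ]
  accepts N d ε I free = subst (+ 2 ℚ./ 3 ℚ.≤_) (sym (oneSided N d ε I free))
    (from-yes (+ 2 ℚ./ 3 ℚ.≤? 1ℚ))

  rejects : ∀ N d .{{_ : NonZero N}} .{{_ : NonZero d}} ε .{{_ : Positive ε}} (I : Input N d) →
            Far (TriangleFree T) d ε (graph I) → + 2 ℚ./ 3 ℚ.≤ Pr[ A N d ε returns false on I ]
  rejects N d ε I far = manyHits⇒rejects T I (rounds d ε)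
    (enoughRounds N d ε h (count≤n (hits T I)) (ε*x≤y⇒ ε (d * N) h
      (subst (ℚ._≤ toℚ h) εdN (far⇒manyHits T ε I far))))
    where
    h = count (hits T I)
    εdN : (ε ℚ.* toℚ d) ℚ.* toℚ N ≡ ε ℚ.* toℚ (d * N)
    εdN = trans (ℚ.*-assoc ε (toℚ d) (toℚ N)) (cong (ε ℚ.*_) (sym (toℚ-* d N)))

  complexity : QueryComplexityAtMost (λ d → 9 * d ^ 2) A
  complexity N d ε I = subst (ℚ._≤ toℚ (9 * d ^ 2)) (ℚ.*-comm ε (toℚ Q)) (ε*x≤y⇐ ε Q (9 * d ^ 2) (begin
    num ε * Q                       ≤⟨ ℕ.*-monoʳ-≤ (num ε) (queries-sampler T I n) ⟩
    num ε * (n * 3)                 ≡⟨ solve 2 (λ a n → a :* (n :* con 3) := con 3 :* (n :* a)) refl (num ε) n ⟩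
    3 * (n * num ε)                 ≤⟨ ℕ.*-monoʳ-≤ 3 (ℕ.m/n*n≤m (3 * (d * d * ↧ₙ ε)) (num ε) {{num≢0 ε}}) ⟩
    -- The factor `d :* (d :* con 1)` below is the unfolding of `d ^ 2`.
    3 * (3 * (d * d * ↧ₙ ε))        ≡⟨ solve 2 (λ d b → con 3 :* (con 3 :* (d :* d :* b)) :=
                                                      con 9 :* (d :* (d :* con 1)) :* b) refl d (↧ₙ ε) ⟩
    9 * d ^ 2 * ↧ₙ ε                ∎))
    where
    n = rounds d ε
    Q = queries (A N d ε) I
    open ℕ.≤-Reasoning
    open ℕ.+-*-Solver
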